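{- For every $r\ge 3$ and $t\ge 2$, \[ \gamma_{r-1}^+(\mathcal D_{r,t+1})\le 1-\frac1t-\frac{1}{36t^2}. \]
   Context: An $r$-graph is a collection of $r$-element subsets (edges) of a finite vertex set. For an $r$-graph $\mathcal H$ and an $(r-1)$-set $S$ of vertices, $d_{\mathcal H}(S)$ is the number of edges containing $S$. For a nonempty $r$-graph $\mathcal H$, the positive $(r-1)$-codegree is $\delta_{r-1}^+(\mathcal H)=\min\{d_{\mathcal H}(S): S\in\binom{V(\mathcal H)}{r-1},\ d_{\mathcal H}(S)>0\}$. For an $r$-graph $F$, $\operatorname{co\text{ - }ex}_{r-1}^+(n,F)$ is the maximum of $\delta_{r-1}^+(\mathcal H)$ over all $F$-free (containing no copy of $F$ as a subgraph) $r$-graphs $\mathcal H$ on $n$ vertices, and $\gamma_{r-1}^+(F)=\lim_{n\to\infty}\operatorname{co\text{ - }ex}_{r-1}^+(n,F)/n$ (this limit exists). The $(r,t)$-daisy $\mathcal D_{r,t}$ is the $r$-graph obtained from the complete graph $K_t$ by adding a fixed set of $r-2$ new vertices to each of its edges. -}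

module Defs where

open import Data.Bool using (Bool; true; false; _∧_; _∨_; not; if_then_else_)
open import Data.Nat using (ℕ; zero; suc; _+_; _∸_; _⊓_; _<ᵇ_; _≡ᵇ_)
open import Data.Fin using (Fin; toℕ)
open import Data.Fin.Properties using (_≟_)
open import Data.Vec using (Vec; []; _∷_; lookup; tabulate; zipWith; foldr)
open import Data.List using (List; []; _∷_; map; _++_; length; allFin)
open import Data.Bool.ListAction using (any; all)
open import Data.Product using (∃; ∃-syntax; _×_)
open import Relation.Nullary.Decidable using (⌊_⌋)
open import Relation.Binary.PropositionalEquality using (_≡_)
open import Function.Definitions using (Injective)
open import Data.Fin.Subset using (Subset; ∣_∣) public

Hypergraph : ℕ → Set
Hypergraph n = Subset n → Bool

Uniform : ∀ {n} → ℕ → Hypergraph n → Set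
Uniform r H = ∀ e → H e ≡ true → ∣ e ∣ ≡ r

NonemptyGraph : ∀ {n} → Hypergraph n → Set
NonemptyGraph {n} H = ∃[ e ] (H e ≡ true)

allSubsets : ∀ n → List (Subset n)
allSubsets zero = [] ∷ []
allSubsets (suc n) = map (true ∷_) (allSubsets n) ++ map (false ∷_) (allSubsets n)

filterᵇ : ∀ {A : Set} → (A → Bool) → List A → List A
filterᵇ p [] = []
filterᵇ p (x ∷ xs) = if p x then x ∷ filterᵇ p xs else filterᵇ p xs

_⊆ᵇ_ : ∀ {n} → Subset n → Subset n → Bool
S ⊆ᵇ e = foldr _ _∧_ true (zipWith (λ a b → not a ∨ b) S e)

codeg : ∀ {n} → Hypergraph n → Subset n → ℕ
codeg {n} H S = length (filterᵇ (λ e → H e ∧ (S ⊆ᵇ e)) (allSubsets n))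

-- minimum of a list (value 0 on the empty list; only used on nonempty lists)
minList : List ℕ → ℕ
minList [] = 0
minList (x ∷ xs) = Data.List.foldr _⊓_ x xs

posCodeg : ∀ {n} → ℕ → Hypergraph n → ℕ
posCodeg {n} r H =
  minList (filterᵇ (λ d → 0 <ᵇ d)
    (map (codeg H) (filterᵇ (λ S → ∣ S ∣ ≡ᵇ (r ∸ 1)) (allSubsets n))))

image : ∀ {m n} → (Fin m → Fin n) → Subset m → Subset n
image {m} f e = tabulate (λ v → any (λ u → lookup e u ∧ ⌊ f u ≟ v ⌋) (allFin m))

Contains : ∀ {m n} → Hypergraph m → Hypergraph n → Set
Contains {m} {n} F H =
  ∃[ f ] (Injective _≡_ _≡_ f × (∀ e → F e ≡ true → H (image f e) ≡ true))

-- The daisy D_{r,s} on vertex set Fin (s + (r ∸ 2)): vertices with index < s form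
-- the clique K_s, the remaining r-2 vertices form the fixed kernel. Edges: kernel
-- together with exactly two clique vertices.
daisy : (r s : ℕ) → Hypergraph (s + (r ∸ 2))
daisy r s e =
  (length (filterᵇ (λ i → lookup e i ∧ (toℕ i <ᵇ s)) (allFin _)) ≡ᵇ 2)
  ∧ all (λ i → (toℕ i <ᵇ s) ∨ lookup e i) (allFin _)

{-# OPTIONS --safe #-}
module Submission where

-- Passing to the link of r - 3 vertices of an edge reduces the claim to a 3-graph in which every
-- pair of positive codegree has codegree at least δ = n - α and no vertex link contains K_{t+1}.
-- Put η = t α - n; if the bound fails then 36 t η < n. Count the quadruples (a, b, c, z) for which
-- abc is an edge but neither acz nor bcz is.
--   * Fix (a, b). Up to at most η exceptional vertices each, the links of a and of b are t-coloured
--     so that equally coloured vertices are non-adjacent. With t² pairs of colours,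
--     Cauchy-Schwarz gives at least about d(ab)² / t² quadruples.
--   * Fix c. In the link of c, a and b are adjacent non-neighbours of z. At most η / (t - 1)
--     vertices z are isolated there, and for any other z such an edge ab must meet an exceptional
--     set of size η, so that it contributes at most 2 α η pairs (a, b).
-- Summed over all edges the two estimates contradict each other. No error term is needed, so the
-- bound holds for every n.

open import Defs
open import Data.Bool using (Bool; true; false; not; if_then_else_; _∧_; _∨_)
open import Data.Bool.ListAction using (any; all)
open import Data.Bool.Properties using (¬-not; T-≡)
open import Data.Empty using (⊥-elim)
open import Data.Fin using (Fin; zero; suc; combine; splitAt; _↑ˡ_; _↑ʳ_; toℕ)
open import Data.Fin.Properties using (_≟_; combine-injectiveˡ; combine-injectiveʳ; splitAt-↑ˡ; splitAt-↑ʳ; splitAt⁻¹-↑ˡ; splitAt⁻¹-↑ʳ; toℕ-↑ˡ; toℕ-↑ʳ; toℕ<n; ↑ˡ-injective)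
import Data.Fin.Properties as Fin
open import Data.List using (List; []; _∷_; length; map; _++_; allFin)
import Data.List as List
open import Data.List.Membership.Propositional using (_∈_)
open import Data.List.Membership.Propositional.Properties using (∈-lookup; ∈-allFin; ∈-map⁺; ∈-++⁺ˡ; ∈-++⁺ʳ)
open import Data.List.Relation.Unary.All using (All; []; _∷_)
import Data.List.Relation.Unary.All as All
open import Data.List.Relation.Unary.AllPairs using (AllPairs; []; _∷_)
open import Data.List.Relation.Unary.Any using (Any; here; there; index)
open import Data.List.Relation.Unary.Any.Properties using (lookup-index)
open import Data.List.Relation.Unary.Unique.Propositional.Properties using (allFin⁺)
open import Data.Nat using (ℕ; zero; suc; _+_; _*_; _∸_; _≤_; _<_; _⊓_; z≤n; s≤s; _≡ᵇ_; _<ᵇ_; >-nonZero)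
open import Data.Nat.Properties hiding (_≟_)
open import Data.Nat.Tactic.RingSolver using (solve-∀)
open import Data.Product using (∃-syntax; Σ-syntax; _×_; _,_; proj₁; proj₂)
open import Data.Sum using (_⊎_; inj₁; inj₂; [_,_]′)
import Data.Sum as Sum
open import Data.Vec using ([]; _∷_; lookup; _[_]≔_)
open import Data.Vec.Properties using (lookup∘update; lookup∘update′; lookup∘tabulate; tabulate∘lookup; tabulate-cong)
open import Function using (_∘_; case_of_)
open import Function.Bundles using (Equivalence)
open import Function.Definitions using (Injective)
open import Relation.Binary.PropositionalEquality using (_≡_; refl; sym; trans; cong; cong₂; subst; subst₂; _≢_)
open import Relation.Nullary using (yes; no; ¬_)
open import Relation.Nullary.Decidable using (⌊_⌋)
open import Algebra.Properties.Semiring.Sum +-*-semiring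
  using (sum; sum-cong-≗; ∑-distrib-+; ∑-comm; *-distribˡ-sum; *-distribʳ-sum)

private variable n : ℕ

-- Finite sums of natural numbers and Cauchy-Schwarz.

𝟙 : Bool → ℕ
𝟙 b = if b then 1 else 0

𝟙≤1 : ∀ b → 𝟙 b ≤ 1
𝟙≤1 true  = ≤-refl
𝟙≤1 false = z≤n

sum-mono : {f g : Fin n → ℕ} → (∀ i → f i ≤ g i) → sum f ≤ sum g
sum-mono {zero}  h = z≤n
sum-mono {suc n} h = +-mono-≤ (h zero) (sum-mono (h ∘ suc))

sum-const : ∀ n c → sum {n} (λ _ → c) ≡ n * c
sum-const zero    c = refl
sum-const (suc n) c = cong (c +_) (sum-const n c)

sum-positive : (f : Fin n → ℕ) → 0 < sum f → ∃[ i ] (0 < f i)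
sum-positive {suc n} f h with f zero in eq
... | suc m = zero , subst (0 <_) (sym eq) (s≤s z≤n)
... | zero  = let i , p = sum-positive (f ∘ suc) h in suc i , p

term≤sum : (f : Fin n → ℕ) (i : Fin n) → f i ≤ sum f
term≤sum f zero    = m≤m+n _ _
term≤sum f (suc i) = ≤-trans (term≤sum (f ∘ suc) i) (m≤n+m _ _)

-- Pigeonhole. Applied to `misses`, it produces a vertex adjacent to a whole clique.
sum<n⇒∃-zero : (f : Fin n → ℕ) → sum f < n → ∃[ i ] (f i ≡ 0)
sum<n⇒∃-zero {suc n} f h with f zero in eq
... | zero  = zero , eq
... | suc m = let i , p = sum<n⇒∃-zero (f ∘ suc) (≤-trans (s≤s (m≤n+m _ m)) (≤-pred h)) in suc i , p

sum-𝟙+sum-𝟙-not : (f : Fin n → Bool) → sum (λ i → 𝟙 (f i)) + sum (λ i → 𝟙 (not (f i))) ≡ n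
sum-𝟙+sum-𝟙-not {n} f = trans (sym (∑-distrib-+ (𝟙 ∘ f) (𝟙 ∘ not ∘ f)))
  (trans (sum-cong-≗ (λ i → one (f i))) (trans (sum-const n 1) (*-identityʳ n)))
  where
  one : ∀ b → 𝟙 b + 𝟙 (not b) ≡ 1
  one true  = refl
  one false = refl

sum*sum : ∀ {m} (f : Fin m → ℕ) (g : Fin n → ℕ) → sum f * sum g ≡ sum λ i → sum λ j → f i * g j
sum*sum f g = trans (*-distribʳ-sum (sum g) f) (sum-cong-≗ λ i → *-distribˡ-sum (f i) g)

2xy≤x²+y² : ∀ x y → 2 * (x * y) ≤ x * x + y * y
2xy≤x²+y² x y with ≤-total x y
... | inj₁ x≤y with d , refl ← m≤n⇒∃[o]m+o≡n x≤y =
  ≤-trans (m≤m+n _ (d * d)) (≤-reflexive (square x d))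
  where
  square : ∀ x d → 2 * (x * (x + d)) + d * d ≡ x * x + (x + d) * (x + d)
  square = solve-∀
... | inj₂ y≤x with d , refl ← m≤n⇒∃[o]m+o≡n y≤x =
  ≤-trans (m≤m+n _ (d * d)) (≤-reflexive (square y d))
  where
  square : ∀ y d → 2 * ((y + d) * y) + d * d ≡ (y + d) * (y + d) + y * y
  square = solve-∀

-- The square is expanded over pairs `i`, `j` and doubled, so that `2xy≤x²+y²` applies to each pair
-- without leaving the naturals.
cauchy-schwarz : ∀ {k} (s : Fin k → ℕ) → sum s * sum s ≤ k * sum (λ j → s j * s j)
cauchy-schwarz {k} s = *-cancelˡ-≤ 2 (begin
  2 * (sum s * sum s)                                  ≡⟨ cong (2 *_) (sum*sum s s) ⟩
  2 * (sum λ i → sum λ j → s i * s j)                  ≡⟨ *-distribˡ-sum 2 (λ i → sum λ j → s i * s j) ⟩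
  (sum λ i → 2 * sum λ j → s i * s j)                  ≡⟨ sum-cong-≗ (λ i → *-distribˡ-sum 2 (λ j → s i * s j)) ⟩
  (sum λ i → sum λ j → 2 * (s i * s j))                ≤⟨ sum-mono (λ i → sum-mono λ j → 2xy≤x²+y² (s i) (s j)) ⟩
  (sum λ i → sum λ j → s i * s i + s j * s j)          ≡⟨ sum-cong-≗ (λ i → ∑-distrib-+ (λ _ → s i * s i) (λ j → s j * s j)) ⟩
  (sum λ i → sum {k} (λ _ → s i * s i) + Q)            ≡⟨ ∑-distrib-+ (λ i → sum {k} λ _ → s i * s i) (λ _ → Q) ⟩
  (sum λ i → sum {k} (λ _ → s i * s i)) + sum {k} (λ _ → Q)
    ≡⟨ cong₂ _+_ (trans (sum-cong-≗ λ i → sum-const k (s i * s i)) (sym (*-distribˡ-sum k λ j → s j * s j))) (sum-const k Q) ⟩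
  k * Q + k * Q                                        ≡⟨ cong (k * Q +_) (sym (+-identityʳ _)) ⟩
  2 * (k * Q)                                          ∎)
  where
  open ≤-Reasoning
  Q = sum λ j → s j * s j

sum-δ : (i : Fin n) (f : Fin n → ℕ) → (sum λ j → 𝟙 ⌊ i ≟ j ⌋ * f j) ≡ f i
sum-δ {suc n} zero f = trans (cong₂ _+_ (+-identityʳ (f zero)) (trans (sum-const n 0) (*-zeroʳ n))) (+-identityʳ _)
sum-δ (suc i) f = trans (sum-cong-≗ λ j → cong (λ b → 𝟙 b * f (suc j)) (≟-suc i j)) (sum-δ i (f ∘ suc))
  where
  ≟-suc : ∀ {n} (i j : Fin n) → ⌊ suc i ≟ suc j ⌋ ≡ ⌊ i ≟ j ⌋
  ≟-suc i j with i ≟ j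
  ... | yes _ = refl
  ... | no  _ = refl

-- The weight `w` is split into `k` colour sums `s j`. Cauchy-Schwarz bounds the square of their
-- total by `k` times the sum of their squares, and each term of the expanded squares belongs to a
-- pair of equal colour, where `P` dominates.
monochromatic-pairs : ∀ {k} (col : Fin n → Fin k) (w : Fin n → ℕ) (P : Fin n → Fin n → ℕ) →
  (∀ c z → col c ≡ col z → w c * w z ≤ P c z) →
  sum w * sum w ≤ k * sum λ c → sum λ z → P c z
monochromatic-pairs {n} {k} col w P h = begin
  sum w * sum w               ≡⟨ cong₂ _*_ Σs Σs ⟩
  sum s * sum s               ≤⟨ cauchy-schwarz s ⟩
  k * sum (λ j → s j * s j)   ≤⟨ *-monoʳ-≤ k Σs² ⟩
  k * sum (λ c → sum λ z → P c z) ∎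
  where
  open ≤-Reasoning
  δ : Fin n → Fin k → ℕ
  δ c j = 𝟙 ⌊ col c ≟ j ⌋
  s : Fin k → ℕ
  s j = sum λ c → δ c j * w c
  Σs : sum w ≡ sum s
  Σs = trans (sum-cong-≗ λ c → sym (sum-δ (col c) λ _ → w c)) (∑-comm λ c j → δ c j * w c)
  bound : ∀ c z → (sum λ j → δ c j * w c * (δ z j * w z)) ≤ P c z
  bound c z = begin
    (sum λ j → δ c j * w c * (δ z j * w z))   ≡⟨ sum-cong-≗ (λ j → *-assoc (δ c j) (w c) _) ⟩
    (sum λ j → δ c j * (w c * (δ z j * w z))) ≡⟨ sum-δ (col c) (λ j → w c * (δ z j * w z)) ⟩
    w c * (δ z (col c) * w z)                 ≤⟨ last ⟩
    P c z                                     ∎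
    where
    last : w c * (δ z (col c) * w z) ≤ P c z
    last with col z ≟ col c
    ... | yes e = subst (λ x → w c * x ≤ P c z) (sym (+-identityʳ (w z))) (h c z (sym e))
    ... | no  _ = subst (_≤ P c z) (sym (*-zeroʳ (w c))) z≤n
  Σs² : sum (λ j → s j * s j) ≤ sum λ c → sum λ z → P c z
  Σs² = begin
    (sum λ j → s j * s j)
      ≡⟨ sum-cong-≗ (λ j → sum*sum (λ c → δ c j * w c) (λ z → δ z j * w z)) ⟩
    (sum λ j → sum λ c → sum λ z → δ c j * w c * (δ z j * w z))
      ≡⟨ ∑-comm (λ j c → sum λ z → δ c j * w c * (δ z j * w z)) ⟩
    (sum λ c → sum λ j → sum λ z → δ c j * w c * (δ z j * w z))
      ≡⟨ sum-cong-≗ (λ c → ∑-comm λ j z → δ c j * w c * (δ z j * w z)) ⟩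
    (sum λ c → sum λ z → sum λ j → δ c j * w c * (δ z j * w z))
      ≤⟨ sum-mono (λ c → sum-mono λ z → bound c z) ⟩
    (sum λ c → sum λ z → P c z) ∎

∑-rotate : (f : Fin n → Fin n → Fin n → ℕ) →
  (sum λ a → sum λ b → sum λ c → f a b c) ≡ (sum λ c → sum λ a → sum λ b → f a b c)
∑-rotate f = trans (sum-cong-≗ λ a → ∑-comm (f a)) (∑-comm λ a c → sum λ b → f a b c)

𝟙-positive : ∀ {b} → 0 < 𝟙 b → b ≡ true
𝟙-positive {true} _ = refl

-- Near-colourings of graphs without a clique on t + 1 vertices.

-- Here g is K_{s+2}-free, i.e. t = s + 1; α bounds the number of non-neighbours of a
-- non-isolated vertex, and η the excess of t α over n.
module KFreeGraph (n s α δ η : ℕ) (g : Fin n → Fin n → Bool)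
  (g-sym : ∀ x y → g x y ≡ g y x)
  (α+δ≡n : α + δ ≡ n)
  (sα<n : s * α < n)
  (α-bound : suc s * α ≤ n + η)
  (minDegree : ∀ x y → g x y ≡ true → δ ≤ sum λ z → 𝟙 (g x z))
  (cliqueFree : ∀ xs → length xs ≡ suc (suc s) → ¬ AllPairs (λ x y → g x y ≡ true) xs)
  where

  Adj : Fin n → Fin n → Set
  Adj x y = g x y ≡ true

  misses : List (Fin n) → Fin n → ℕ
  misses []       z = 0
  misses (x ∷ xs) z = 𝟙 (not (g x z)) + misses xs z

  Sparse : Fin n → Set
  Sparse x = (sum λ z → 𝟙 (not (g x z))) ≤ α

  fewNonneighbours : ∀ x y → Adj x y → Sparse x
  fewNonneighbours x y xy = +-cancelʳ-≤ δ _ α (begin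
    (sum λ z → 𝟙 (not (g x z))) + δ                       ≤⟨ +-monoʳ-≤ _ (minDegree x y xy) ⟩
    (sum λ z → 𝟙 (not (g x z))) + sum (λ z → 𝟙 (g x z))   ≡⟨ +-comm (sum λ z → 𝟙 (not (g x z))) _ ⟩
    sum (λ z → 𝟙 (g x z)) + (sum λ z → 𝟙 (not (g x z)))   ≡⟨ sum-𝟙+sum-𝟙-not (g x) ⟩
    n                                                     ≡⟨ sym α+δ≡n ⟩
    α + δ                                                 ∎)
    where open ≤-Reasoning

  sum-misses : ∀ {xs} → All Sparse xs → sum (misses xs) ≤ length xs * α
  sum-misses []       = ≤-reflexive (trans (sum-const n 0) (*-zeroʳ n))
  sum-misses {x ∷ xs} (p ∷ ps) =
    ≤-trans (≤-reflexive (∑-distrib-+ _ (misses xs))) (+-mono-≤ p (sum-misses ps))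

  misses≡0⇒adj : ∀ xs z → misses xs z ≡ 0 → All (Adj z) xs
  misses≡0⇒adj []       z e = []
  misses≡0⇒adj (x ∷ xs) z e with g x z in eq
  ... | true  = trans (g-sym z x) eq ∷ misses≡0⇒adj xs z e

  misses>0⇒nonadj : ∀ xs z → 0 < misses xs z → Any (λ x → g x z ≡ false) xs
  misses>0⇒nonadj (x ∷ xs) z p with g x z in eq
  ... | true  = there (misses>0⇒nonadj xs z p)
  ... | false = here eq

  nonadj⇒misses>0 : ∀ {xs x} z → x ∈ xs → g x z ≡ false → 0 < misses xs z
  nonadj⇒misses>0 z (here refl) e rewrite e = s≤s z≤n
  nonadj⇒misses>0 {y ∷ ys} z (there p) e = ≤-trans (nonadj⇒misses>0 z p e) (m≤n+m _ (𝟙 (not (g y z))))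

  isolated⇒misses : ∀ xs z → (∀ y → g z y ≡ false) → misses xs z ≡ length xs
  isolated⇒misses []       z iso = refl
  isolated⇒misses (x ∷ xs) z iso rewrite g-sym x z | iso x = cong suc (isolated⇒misses xs z iso)

  -- Greedy construction: a clique of at most `s` sparse vertices is missed at most `s * α < n`
  -- times in all, so some vertex is adjacent to every member. Keeping `x` in the clique makes each
  -- new vertex non-isolated, hence sparse.
  extendClique : ∀ m {x y} → Adj x y → m ≤ s →
    ∃[ xs ] (length xs ≡ suc m × AllPairs Adj xs × All Sparse xs × x ∈ xs)
  extendClique zero    {x} {y} xy _ = x ∷ [] , refl , [] ∷ [] , fewNonneighbours x y xy ∷ [] , here refl
  extendClique (suc m) {x} {y} xy m<s
    with xs , len , pairs , sparse , x∈xs ← extendClique m xy (<⇒≤ m<s)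
    with z , z0 ← sum<n⇒∃-zero (misses xs)
           (≤-<-trans (sum-misses sparse) (≤-<-trans (*-monoˡ-≤ α (subst (_≤ s) (sym len) m<s)) sα<n))
    with adj ← misses≡0⇒adj xs z z0
    = z ∷ xs , cong suc len , adj ∷ pairs , fewNonneighbours z x (All.lookup adj x∈xs) ∷ sparse , there x∈xs

  -- As `c` and `z` each miss at most one member and both miss `x`, each is adjacent to all of `xs`
  -- without `x`. The last component records that `ys` lies within `xs`; the recursion needs it to
  -- keep the head adjacent to the new tail.
  dropCommonNonneighbour : ∀ {xs x c z} → AllPairs Adj xs → x ∈ xs → g x c ≡ false → g x z ≡ false →
    misses xs c ≤ 1 → misses xs z ≤ 1 →
    ∃[ ys ] (suc (length ys) ≡ length xs × AllPairs Adj ys × All (Adj c) ys × All (Adj z) ys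
      × (∀ {P : Fin n → Set} → All P xs → All P ys))
  dropCommonNonneighbour {x ∷ xs} {c = c} {z} (_ ∷ pairs) (here refl) xc xz mc mz
    rewrite xc | xz =
    xs , refl , pairs , misses≡0⇒adj xs c (n≤0⇒n≡0 (≤-pred mc)) , misses≡0⇒adj xs z (n≤0⇒n≡0 (≤-pred mz))
      , λ { (_ ∷ ps) → ps }
  dropCommonNonneighbour {y ∷ xs} {c = c} {z} (yxs ∷ pairs) (there p) xc xz mc mz
    with g y c in yc | g y z in yz
  -- A miss at the head, besides the one at `x` in the tail, would make two.
  ... | false | _     = ⊥-elim (<⇒≱ (nonadj⇒misses>0 c p xc) (≤-pred mc))
  ... | true  | false = ⊥-elim (<⇒≱ (nonadj⇒misses>0 z p xz) (≤-pred mz))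
  ... | true  | true
    with ys , len , pairs′ , cys , zys , inc ← dropCommonNonneighbour pairs p xc xz mc mz
    = y ∷ ys , cong suc len , inc yxs ∷ pairs′ , trans (g-sym c y) yc ∷ cys , trans (g-sym z y) yz ∷ zys
      , λ { (q ∷ qs) → q ∷ inc qs }

  isolated : Fin n → Bool
  isolated z = sum (λ y → 𝟙 (g z y)) ≡ᵇ 0

  isolated-nonadj : ∀ z → isolated z ≡ true → ∀ y → g z y ≡ false
  isolated-nonadj z iso y with g z y in zy | sum (λ y → 𝟙 (g z y)) in eq | term≤sum (λ y → 𝟙 (g z y)) y
  ... | false | _    | _ = refl
  ... | true  | zero | ()

  -- Given a t-clique through x, the non-neighbourhoods of its members cover all vertices, with
  -- total excess at most η. The bad vertices are those covered twice; a good vertex is coloured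
  -- by the clique member it misses, and two adjacent good vertices of one colour could replace
  -- that member to give a (t+1)-clique. Isolated vertices are covered t times.
  record Structure (x : Fin n) : Set where
    field
      bad         : Fin n → Bool
      colour      : Fin n → Fin (suc s)
      bad≤η       : sum (λ z → 𝟙 (bad z)) ≤ η
      monochromatic-nonadj : ∀ c z → bad c ≡ false → bad z ≡ false → colour c ≡ colour z → g c z ≡ false
      nonneighbours-nonadj : ∀ c z → bad c ≡ false → bad z ≡ false → g x c ≡ false → g x z ≡ false → g c z ≡ false
      s*isolated≤η : s * sum (λ z → 𝟙 (isolated z)) ≤ η

  structure : ∀ {x y} → Adj x y → Structure x
  structure {x} {y} xy
    with xs , len , pairs , sparse , x∈xs ← extendClique s xy ≤-refl
    = record
    { bad = bad
    -- The first clique member that `z` misses, its position transported along `len` to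
    -- `Fin (suc s)`.
    ; colour = λ z → subst Fin len (index (missed z))
    ; bad≤η = excess (𝟙 ∘ bad) bad-excess
    ; monochromatic-nonadj = λ c z bc bz e →
        let e′ = subst-injective len e in
        nonadj (∈-lookup (index (missed c))) bc bz (lookup-index (missed c))
          (subst (λ i → g (List.lookup xs i) z ≡ false) (sym e′) (lookup-index (missed z)))
    ; nonneighbours-nonadj = λ c z bc bz xc xz → nonadj x∈xs bc bz xc xz
    ; s*isolated≤η = subst (_≤ η) (sym (*-distribˡ-sum s (𝟙 ∘ isolated))) (excess (λ z → s * 𝟙 (isolated z)) iso-excess)
    }
    where
    bad : Fin n → Bool
    bad z = 1 <ᵇ misses xs z

    misses>0 : ∀ z → 0 < misses xs z
    misses>0 z with misses xs z in eq
    ... | suc _ = s≤s z≤n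
    -- Otherwise `z` would extend the t-clique. This covers `z` in `xs` too: `cliqueFree` speaks of
    -- lists, which may repeat a vertex, so it also excludes loops.
    ... | zero  = ⊥-elim (cliqueFree (z ∷ xs) (cong suc len) (misses≡0⇒adj xs z eq ∷ pairs))

    missed : ∀ z → Any (λ x → g x z ≡ false) xs
    missed z = misses>0⇒nonadj xs z (misses>0 z)

    -- The misses sum to at most `suc s * α`, hence to at most `n + η`. One miss per vertex uses up
    -- `n` of these and leaves `η` for `f`.
    excess : (f : Fin n → ℕ) → (∀ z → 1 + f z ≤ misses xs z) → sum f ≤ η
    excess f h = +-cancelˡ-≤ n _ _ (begin
      n + sum f                     ≡⟨ cong (_+ sum f) (sym (trans (sum-const n 1) (*-identityʳ n))) ⟩
      sum {n} (λ _ → 1) + sum f     ≡⟨ sym (∑-distrib-+ (λ _ → 1) f) ⟩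
      sum (λ z → 1 + f z)           ≤⟨ sum-mono h ⟩
      sum (misses xs)               ≤⟨ sum-misses sparse ⟩
      length xs * α                 ≡⟨ cong (_* α) len ⟩
      suc s * α                     ≤⟨ α-bound ⟩
      n + η                         ∎)
      where open ≤-Reasoning

    bad-excess : ∀ z → 1 + 𝟙 (bad z) ≤ misses xs z
    bad-excess z with misses xs z | misses>0 z
    ... | suc zero    | _ = ≤-refl
    ... | suc (suc _) | _ = s≤s (s≤s z≤n)

    iso-excess : ∀ z → 1 + s * 𝟙 (isolated z) ≤ misses xs z
    iso-excess z with isolated z in eq
    ... | false = subst (λ v → suc v ≤ misses xs z) (sym (*-zeroʳ s)) (misses>0 z)
    ... | true  = ≤-reflexive (trans (cong suc (*-identityʳ s))
                    (sym (trans (isolated⇒misses xs z (isolated-nonadj z eq)) len)))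

    subst-injective : ∀ {a b} (e : a ≡ b) {i j : Fin a} → subst Fin e i ≡ subst Fin e j → i ≡ j
    subst-injective refl p = p

    good⇒misses≤1 : ∀ z → bad z ≡ false → misses xs z ≤ 1
    good⇒misses≤1 z e with misses xs z
    ... | zero  = z≤n
    ... | suc zero = ≤-refl

    nonadj : ∀ {w c z} → w ∈ xs → bad c ≡ false → bad z ≡ false → g w c ≡ false → g w z ≡ false → g c z ≡ false
    nonadj {w} {c} {z} w∈xs bc bz wc wz with g c z in cz
    ... | false = refl
    ... | true
      with ys , len′ , pairs′ , cys , zys , _ ←
        dropCommonNonneighbour pairs w∈xs wc wz (good⇒misses≤1 c bc) (good⇒misses≤1 z bz)
      = ⊥-elim (cliqueFree (c ∷ z ∷ ys) (cong suc (trans len′ len)) ((cz ∷ cys) ∷ zys ∷ pairs′))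

  degree : Fin n → ℕ
  degree z = sum λ y → 𝟙 (g z y)

  edges : ℕ
  edges = sum λ a → sum λ b → 𝟙 (g a b)

  nonneighbourEdges : Fin n → ℕ
  nonneighbourEdges z = sum λ a → sum λ b → 𝟙 (g a b) * (𝟙 (not (g z a)) * 𝟙 (not (g z b)))

  nonneighbourEdges≤edges : ∀ z → nonneighbourEdges z ≤ edges
  nonneighbourEdges≤edges z = sum-mono λ a → sum-mono λ b →
    ≤-trans (*-monoʳ-≤ (𝟙 (g a b)) (*-mono-≤ (𝟙≤1 (not (g z a))) (𝟙≤1 (not (g z b))))) (≤-reflexive (*-identityʳ _))

  -- An edge inside the non-neighbourhood of z must meet the bad set.
  nonneighbourEdges≤2αη : ∀ {z y} → Adj z y → nonneighbourEdges z ≤ 2 * α * η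
  nonneighbourEdges≤2αη {z} {y} zy = begin
    nonneighbourEdges z
      ≤⟨ sum-mono (λ a → sum-mono λ b → pointwise a b) ⟩
    (sum λ a → sum λ b → B a * A b + A a * B b)
      ≡⟨ sum-cong-≗ (λ a → ∑-distrib-+ (λ b → B a * A b) (λ b → A a * B b)) ⟩
    (sum λ a → (sum λ b → B a * A b) + (sum λ b → A a * B b))
      ≡⟨ ∑-distrib-+ (λ a → sum λ b → B a * A b) (λ a → sum λ b → A a * B b) ⟩
    (sum λ a → sum λ b → B a * A b) + (sum λ a → sum λ b → A a * B b)
      ≡⟨ cong₂ _+_ (sym (sum*sum B A)) (sym (sum*sum A B)) ⟩
    sum B * sum A + sum A * sum B
      ≤⟨ +-mono-≤ (*-mono-≤ bad≤η sparse) (*-mono-≤ sparse bad≤η) ⟩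
    η * α + α * η
      ≡⟨ rearrange α η ⟩
    2 * α * η ∎
    where
    open ≤-Reasoning
    open Structure (structure zy)
    sparse = fewNonneighbours z y zy
    A B : Fin n → ℕ
    A a = 𝟙 (not (g z a))
    B a = 𝟙 (bad a)
    rearrange : ∀ α η → η * α + α * η ≡ 2 * α * η
    rearrange = solve-∀
    pointwise : ∀ a b → 𝟙 (g a b) * (A a * A b) ≤ B a * A b + A a * B b
    pointwise a b with g a b in ab | g z a in za | g z b in zb | bad a in ba | bad b in bb
    ... | false | _     | _     | _     | _     = z≤n
    ... | true  | true  | _     | _     | _     = z≤n
    ... | true  | false | true  | _     | _     = z≤n
    ... | true  | false | false | true  | _     = s≤s z≤n
    ... | true  | false | false | false | true  = ≤-refl
    ... | true  | false | false | false | false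
      with () ← trans (sym ab) (nonneighbours-nonadj a b ba bb za zb)

  -- An isolated `z` gets the trivial bound. Otherwise `degree z` is at least `δ`, so the factor `δ`
  -- can be traded for `degree z`, which sums to `edges` over all `z`; the error terms then add up
  -- to a multiple of `edges`.
  δ*nonneighbourEdges : ∀ z →
    δ * nonneighbourEdges z ≤ δ * edges * 𝟙 (isolated z) + 2 * α * η * degree z
  δ*nonneighbourEdges z with degree z in eq
  ... | zero  = ≤-trans (*-monoʳ-≤ δ (nonneighbourEdges≤edges z))
                  (≤-trans (≤-reflexive (sym (*-identityʳ _))) (m≤m+n _ _))
  ... | suc d
    with y , p ← sum-positive (λ y → 𝟙 (g z y)) (subst (0 <_) (sym eq) (s≤s z≤n))
    with zy ← 𝟙-positive p = begin
    δ * nonneighbourEdges z               ≤⟨ *-mono-≤ (subst (δ ≤_) eq (minDegree z y zy)) (nonneighbourEdges≤2αη zy) ⟩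
    suc d * (2 * α * η)                   ≡⟨ *-comm (suc d) _ ⟩
    2 * α * η * suc d                     ≤⟨ m≤n+m _ _ ⟩
    δ * edges * 0 + 2 * α * η * suc d     ∎
    where open ≤-Reasoning

  -- A `Structure` is available only at an endpoint of an edge; without edges both sides vanish.
  s*isolated*edges : s * sum (𝟙 ∘ isolated) * edges ≤ η * edges
  s*isolated*edges with edges in eq
  ... | zero  = ≤-reflexive (trans (*-zeroʳ (s * sum (𝟙 ∘ isolated))) (sym (*-zeroʳ η)))
  ... | suc m
    with a , p ← sum-positive (λ a → sum λ b → 𝟙 (g a b)) (subst (0 <_) (sym eq) (s≤s z≤n))
    with b , q ← sum-positive (λ b → 𝟙 (g a b)) p
    = *-monoˡ-≤ (suc m) (Structure.s*isolated≤η (structure (𝟙-positive q)))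

  sum-nonneighbourEdges : s * δ * sum nonneighbourEdges ≤ (δ * η + 2 * s * α * η) * edges
  sum-nonneighbourEdges = begin
    s * δ * sum nonneighbourEdges
      ≡⟨ *-assoc s δ _ ⟩
    s * (δ * sum nonneighbourEdges)
      ≡⟨ cong (s *_) (*-distribˡ-sum δ nonneighbourEdges) ⟩
    s * (sum λ z → δ * nonneighbourEdges z)
      ≤⟨ *-monoʳ-≤ s (sum-mono δ*nonneighbourEdges) ⟩
    s * (sum λ z → δ * edges * 𝟙 (isolated z) + 2 * α * η * degree z)
      ≡⟨ cong (s *_) (∑-distrib-+ (λ z → δ * edges * 𝟙 (isolated z)) (λ z → 2 * α * η * degree z)) ⟩
    s * ((sum λ z → δ * edges * 𝟙 (isolated z)) + (sum λ z → 2 * α * η * degree z))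
      ≡⟨ cong (s *_) (cong₂ _+_ (sym (*-distribˡ-sum (δ * edges) (𝟙 ∘ isolated))) (sym (*-distribˡ-sum (2 * α * η) degree))) ⟩
    s * (δ * edges * I + 2 * α * η * edges)
      ≡⟨ regroup s δ edges I α η ⟩
    δ * (s * I * edges) + 2 * s * α * η * edges
      ≤⟨ +-monoˡ-≤ _ (*-monoʳ-≤ δ s*isolated*edges) ⟩
    δ * (η * edges) + 2 * s * α * η * edges
      ≡⟨ collect s δ edges α η ⟩
    (δ * η + 2 * s * α * η) * edges ∎
    where
    open ≤-Reasoning
    I = sum (𝟙 ∘ isolated)
    regroup : ∀ s δ e i α η → s * (δ * e * i + 2 * α * η * e) ≡ δ * (s * i * e) + 2 * s * α * η * e
    regroup = solve-∀
    collect : ∀ s δ e α η → δ * (η * e) + 2 * s * α * η * e ≡ (δ * η + 2 * s * α * η) * e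
    collect = solve-∀

-- Double counting in a 3-graph.

module ThreeGraph (n s α δ η : ℕ) (T : Fin n → Fin n → Fin n → Bool)
  (T-swap₁₂ : ∀ a b c → T a b c ≡ T b a c)
  (T-swap₂₃ : ∀ a b c → T a b c ≡ T a c b)
  (α+δ≡n : α + δ ≡ n)
  (sα<n : s * α < n)
  (α-bound : suc s * α ≤ n + η)
  (minCodegree : ∀ a b c → T a b c ≡ true → δ ≤ sum λ z → 𝟙 (T a b z))
  (linkCliqueFree : ∀ a xs → length xs ≡ suc (suc s) → ¬ AllPairs (λ x y → T a x y ≡ true) xs)
  where

  module Link (a : Fin n) = KFreeGraph n s α δ η (T a) (T-swap₂₃ a) α+δ≡n sα<n α-bound
    (minCodegree a) (linkCliqueFree a)

  t : ℕ
  t = suc s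

  codegree : Fin n → Fin n → ℕ
  codegree a b = sum λ c → 𝟙 (T a b c)

  commonMiss : Fin n → Fin n → Fin n → Fin n → ℕ
  commonMiss a b c z = 𝟙 (T a b c) * (𝟙 (not (T a c z)) * 𝟙 (not (T b c z)))

  total : ℕ
  total = sum λ a → sum λ b → codegree a b

  totalMiss : ℕ
  totalMiss = sum λ a → sum λ b → sum λ c → sum λ z → commonMiss a b c z

  -- Outside the bad sets, colour each c by its pair of colours in the links of a and b.
  commonMiss-lower : ∀ a b →
    codegree a b * δ ≤ t * t * (sum λ c → sum λ z → commonMiss a b c z) + 4 * η * codegree a b
  commonMiss-lower a b with codegree a b in eq
  ... | zero  = z≤n
  ... | suc m
    with c₀ , p ← sum-positive (λ c → 𝟙 (T a b c)) (subst (0 <_) (sym eq) (s≤s z≤n))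
    with abc₀ ← 𝟙-positive p = subst (λ d → d * δ ≤ t * t * L + 4 * η * d) eq (begin
    -- `W` counts the `c` that complete `a`, `b` to an edge and are bad in neither link. Replacing
    -- `d` by `W` twice costs at most `2 * η * d` each time.
    d * δ                              ≤⟨ *-monoʳ-≤ d (minCodegree a b c₀ abc₀) ⟩
    d * d                              ≤⟨ *-monoʳ-≤ d d≤W+2η ⟩
    d * (W + 2 * η)                    ≡⟨ e₁ d W η ⟩
    d * W + 2 * η * d                  ≤⟨ +-monoˡ-≤ _ (*-monoˡ-≤ W d≤W+2η) ⟩
    (W + 2 * η) * W + 2 * η * d        ≡⟨ e₂ d W η ⟩
    W * W + (2 * η * W + 2 * η * d)    ≤⟨ +-mono-≤ W² (+-monoˡ-≤ _ (*-monoʳ-≤ (2 * η) W≤d)) ⟩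
    t * t * L + (2 * η * d + 2 * η * d) ≡⟨ e₃ (t * t * L) η d ⟩
    t * t * L + 4 * η * d              ∎)
    where
    open ≤-Reasoning
    module A = Link.Structure a (Link.structure a abc₀)
    module B = Link.Structure b (Link.structure b (trans (T-swap₁₂ b a c₀) abc₀))
    d L W : ℕ
    d = codegree a b
    L = sum λ c → sum λ z → commonMiss a b c z
    w : Fin n → ℕ
    w c = 𝟙 (T a b c) * (𝟙 (not (A.bad c)) * 𝟙 (not (B.bad c)))
    W = sum w
    e₁ : ∀ d w η → d * (w + 2 * η) ≡ d * w + 2 * η * d
    e₁ = solve-∀
    e₂ : ∀ d w η → (w + 2 * η) * w + 2 * η * d ≡ w * w + (2 * η * w + 2 * η * d)
    e₂ = solve-∀
    e₃ : ∀ l η d → l + (2 * η * d + 2 * η * d) ≡ l + 4 * η * d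
    e₃ = solve-∀
    W≤d : W ≤ d
    W≤d = sum-mono λ c → ≤-trans
      (*-monoʳ-≤ (𝟙 (T a b c)) (*-mono-≤ (𝟙≤1 (not (A.bad c))) (𝟙≤1 (not (B.bad c))))) (≤-reflexive (*-identityʳ _))
    pointwise : ∀ c → 𝟙 (T a b c) ≤ w c + (𝟙 (A.bad c) + 𝟙 (B.bad c))
    pointwise c with T a b c | A.bad c | B.bad c
    ... | false | _     | _     = z≤n
    ... | true  | true  | _     = s≤s z≤n
    ... | true  | false | true  = s≤s z≤n
    ... | true  | false | false = s≤s z≤n
    d≤W+2η : d ≤ W + 2 * η
    d≤W+2η = begin
      d                                                        ≤⟨ sum-mono pointwise ⟩
      (sum λ c → w c + (𝟙 (A.bad c) + 𝟙 (B.bad c)))            ≡⟨ ∑-distrib-+ w (λ c → 𝟙 (A.bad c) + 𝟙 (B.bad c)) ⟩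
      W + (sum λ c → 𝟙 (A.bad c) + 𝟙 (B.bad c))                ≡⟨ cong (W +_) (∑-distrib-+ (𝟙 ∘ A.bad) (𝟙 ∘ B.bad)) ⟩
      W + (sum (𝟙 ∘ A.bad) + sum (𝟙 ∘ B.bad))                  ≤⟨ +-monoʳ-≤ W (+-mono-≤ A.bad≤η B.bad≤η) ⟩
      W + (η + η)                                              ≡⟨ cong (λ x → W + (η + x)) (sym (+-identityʳ η)) ⟩
      W + 2 * η                                                ∎
    colour : Fin n → Fin (t * t)
    colour c = combine (A.colour c) (B.colour c)
    same-colour : ∀ c z → colour c ≡ colour z → w c * w z ≤ commonMiss a b c z
    same-colour c z e with T a b c | A.bad c in ac | B.bad c in bc | T a b z | A.bad z in az | B.bad z in bz
    ... | false | _     | _     | _     | _     | _ = z≤n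
    ... | true  | true  | _     | _     | _     | _ = z≤n
    ... | true  | false | true  | _     | _     | _ = z≤n
    ... | true  | false | false | false | _     | _ = z≤n
    ... | true  | false | false | true  | true  | _ = z≤n
    ... | true  | false | false | true  | false | true = z≤n
    ... | true  | false | false | true  | false | false
      rewrite A.monochromatic-nonadj c z ac az (combine-injectiveˡ (A.colour c) (B.colour c) (A.colour z) (B.colour z) e)
            | B.monochromatic-nonadj c z bc bz (combine-injectiveʳ (A.colour c) (B.colour c) (A.colour z) (B.colour z) e)
            = ≤-refl
    W² : W * W ≤ t * t * L
    W² = monochromatic-pairs colour w (commonMiss a b) same-colour

  totalMiss-lower : δ * total ≤ t * t * totalMiss + 4 * η * total
  totalMiss-lower = begin
    δ * total
      ≡⟨ pull δ codegree ⟩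
    (sum λ a → sum λ b → δ * codegree a b)
      ≤⟨ sum-mono (λ a → sum-mono λ b → ≤-trans (≤-reflexive (*-comm δ (codegree a b))) (commonMiss-lower a b)) ⟩
    (sum λ a → sum λ b → t * t * L a b + 4 * η * codegree a b)
      ≡⟨ sum-cong-≗ (λ a → ∑-distrib-+ (λ b → t * t * L a b) (λ b → 4 * η * codegree a b)) ⟩
    (sum λ a → (sum λ b → t * t * L a b) + (sum λ b → 4 * η * codegree a b))
      ≡⟨ ∑-distrib-+ (λ a → sum λ b → t * t * L a b) (λ a → sum λ b → 4 * η * codegree a b) ⟩
    (sum λ a → sum λ b → t * t * L a b) + (sum λ a → sum λ b → 4 * η * codegree a b)
      ≡⟨ cong₂ _+_ (sym (pull (t * t) L)) (sym (pull (4 * η) codegree)) ⟩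
    t * t * totalMiss + 4 * η * total ∎
    where
    open ≤-Reasoning
    L : Fin n → Fin n → ℕ
    L a b = sum λ c → sum λ z → commonMiss a b c z
    pull : ∀ x (f : Fin n → Fin n → ℕ) → x * (sum λ a → sum λ b → f a b) ≡ (sum λ a → sum λ b → x * f a b)
    pull x f = trans (*-distribˡ-sum x (λ a → sum λ b → f a b)) (sum-cong-≗ λ a → *-distribˡ-sum x (f a))

  T-rotate : ∀ a b c → T a b c ≡ T c a b
  T-rotate a b c = trans (T-swap₂₃ a b c) (T-swap₁₂ a c b)

  total≡edges : total ≡ sum λ c → Link.edges c
  total≡edges = trans (∑-rotate λ a b c → 𝟙 (T a b c))
    (sum-cong-≗ λ c → sum-cong-≗ λ a → sum-cong-≗ λ b → cong 𝟙 (T-rotate a b c))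

  -- Seen from `c`, such a quadruple is a vertex `z` together with an edge `a b` of the link of `c`
  -- both of whose ends miss `z`.
  totalMiss≡nonneighbourEdges : totalMiss ≡ sum λ c → sum (Link.nonneighbourEdges c)
  totalMiss≡nonneighbourEdges = trans (∑-rotate λ a b c → sum λ z → commonMiss a b c z)
    (sum-cong-≗ λ c → trans (∑-rotate λ a b z → commonMiss a b c z)
      (sum-cong-≗ λ z → sum-cong-≗ λ a → sum-cong-≗ λ b →
        cong₂ _*_ (cong 𝟙 (T-rotate a b c))
          (cong₂ _*_ (cong (𝟙 ∘ not) (flip a c z)) (cong (𝟙 ∘ not) (flip b c z)))))
    where
    flip : ∀ a c z → T a c z ≡ T c z a
    flip a c z = sym (T-rotate c z a)

  totalMiss-upper : s * δ * totalMiss ≤ (δ * η + 2 * s * α * η) * total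
  totalMiss-upper = begin
    s * δ * totalMiss
      ≡⟨ cong (s * δ *_) totalMiss≡nonneighbourEdges ⟩
    s * δ * (sum λ c → sum (Link.nonneighbourEdges c))
      ≡⟨ *-distribˡ-sum (s * δ) (λ c → sum (Link.nonneighbourEdges c)) ⟩
    (sum λ c → s * δ * sum (Link.nonneighbourEdges c))
      ≤⟨ sum-mono (λ c → Link.sum-nonneighbourEdges c) ⟩
    (sum λ c → (δ * η + 2 * s * α * η) * Link.edges c)
      ≡⟨ sym (*-distribˡ-sum (δ * η + 2 * s * α * η) (λ c → Link.edges c)) ⟩
    (δ * η + 2 * s * α * η) * (sum λ c → Link.edges c)
      ≡⟨ cong ((δ * η + 2 * s * α * η) *_) (sym total≡edges) ⟩
    (δ * η + 2 * s * α * η) * total ∎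
    where open ≤-Reasoning

  -- Once `totalMiss` is eliminated between its lower and upper bounds, every term is a multiple of
  -- `total`, which the edge `abc` makes positive, so it cancels.
  codegree-inequality : ∀ {a b c} → T a b c ≡ true →
    s * δ * δ ≤ 4 * s * δ * η + t * t * (δ * η + 2 * s * α * η)
  codegree-inequality {a} {b} {c} abc = *-cancelʳ-≤ _ _ total {{>-nonZero total>0}} (begin
    s * δ * δ * total                                     ≡⟨ *-assoc (s * δ) δ total ⟩
    s * δ * (δ * total)                                   ≤⟨ *-monoʳ-≤ (s * δ) totalMiss-lower ⟩
    s * δ * (t * t * totalMiss + 4 * η * total)           ≡⟨ e₁ s δ (t * t) totalMiss η total ⟩
    t * t * (s * δ * totalMiss) + 4 * s * δ * η * total   ≤⟨ +-monoˡ-≤ _ (*-monoʳ-≤ (t * t) totalMiss-upper) ⟩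
    t * t * (X * total) + 4 * s * δ * η * total           ≡⟨ e₂ (t * t) X total (4 * s * δ * η) ⟩
    (4 * s * δ * η + t * t * X) * total                   ∎)
    where
    open ≤-Reasoning
    X = δ * η + 2 * s * α * η
    e₁ : ∀ s δ q m η e → s * δ * (q * m + 4 * η * e) ≡ q * (s * δ * m) + 4 * s * δ * η * e
    e₁ = solve-∀
    e₂ : ∀ q x e y → q * (x * e) + y * e ≡ (y + q * x) * e
    e₂ = solve-∀
    total>0 : 0 < total
    total>0 = begin
      1                            ≡⟨ cong 𝟙 (sym abc) ⟩
      𝟙 (T a b c)                  ≤⟨ term≤sum (λ c → 𝟙 (T a b c)) c ⟩
      codegree a b                 ≤⟨ term≤sum (codegree a) b ⟩
      (sum λ b → codegree a b)     ≤⟨ term≤sum (λ a → sum λ b → codegree a b) a ⟩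
      total                        ∎

-- Numerical contradiction when the bound fails.

module Arithmetic (p n α δ : ℕ) (α+δ≡n : α + δ ≡ n)
  (large : (36 * (2 + p) * (2 + p) ∸ 36 * (2 + p) ∸ 1) * n < 36 * (2 + p) * (2 + p) * δ)
  where

  open ≤-Reasoning

  s t η : ℕ
  s = 1 + p
  t = 2 + p
  -- Truncated subtraction: if `t * α` is below `n`, then `η` is 0 and `α-bound` still holds.
  η = t * α ∸ n

  α-bound : t * α ≤ n + η
  α-bound = m≤n+m∸n (t * α) n

  coefficient : 36 * t * t ∸ 36 * t ∸ 1 ≡ 71 + 108 * p + 36 * p * p
  coefficient = trans (∸-+-assoc (36 * t * t) (36 * t) 1)
    (trans (cong (_∸ (36 * t + 1)) (split p)) (m+n∸n≡m _ (36 * t + 1)))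
    where
    split : ∀ p → 36 * (2 + p) * (2 + p) ≡ 71 + 108 * p + 36 * p * p + (36 * (2 + p) + 1)
    split = solve-∀

  -- This is `large` in terms of `α`: α/n < 1/t + 1/(36t²), only slightly above 1/t.
  36t²α<[36t+1]n : 36 * t * t * α < (36 * t + 1) * n
  36t²α<[36t+1]n = +-cancelʳ-< (36 * t * t * δ) _ _ (begin-strict
    36 * t * t * α + 36 * t * t * δ                   ≡⟨ sym (*-distribˡ-+ (36 * t * t) α δ) ⟩
    36 * t * t * (α + δ)                              ≡⟨ cong (36 * t * t *_) α+δ≡n ⟩
    36 * t * t * n                                    ≡⟨ split p n ⟩
    (36 * t + 1) * n + (71 + 108 * p + 36 * p * p) * n <⟨ +-monoʳ-< ((36 * t + 1) * n) (subst (λ x → x * n < 36 * t * t * δ) coefficient large) ⟩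
    (36 * t + 1) * n + 36 * t * t * δ                 ∎)
    where
    split : ∀ p n → 36 * (2 + p) * (2 + p) * n ≡ (36 * (2 + p) + 1) * n + (71 + 108 * p + 36 * p * p) * n
    split = solve-∀

  n>0 : 0 < n
  n>0 = n≢0⇒n>0 λ n≡0 → n≮0 (≤-trans 36t²α<[36t+1]n (≤-reflexive (trans (cong ((36 * t + 1) *_) n≡0) (*-zeroʳ (36 * t + 1)))))

  sα<n : s * α < n
  sα<n = *-cancelˡ-< (36 * t * t) _ _ (begin-strict
    36 * t * t * (s * α)          ≡⟨ swap (36 * t * t) s α ⟩
    s * (36 * t * t * α)          ≤⟨ *-monoʳ-≤ s (<⇒≤ 36t²α<[36t+1]n) ⟩
    s * ((36 * t + 1) * n)        ≡⟨ sym (*-assoc s (36 * t + 1) n) ⟩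
    -- 36t² exceeds (t - 1)(36t + 1) by 35t + 1, which is 71 + 35p.
    s * (36 * t + 1) * n          <⟨ *-monoˡ-< n {{>-nonZero n>0}} (≤-trans (m≤m+n _ (70 + 35 * p)) (≤-reflexive (gap p))) ⟩
    36 * t * t * n                ∎)
    where
    swap : ∀ x y z → x * (y * z) ≡ y * (x * z)
    swap = solve-∀
    gap : ∀ p → suc ((1 + p) * (36 * (2 + p) + 1)) + (70 + 35 * p) ≡ 36 * (2 + p) * (2 + p)
    gap = solve-∀

  36tη<n : 36 * t * η < n
  36tη<n = begin-strict
    36 * t * (t * α ∸ n)              ≡⟨ *-distribˡ-∸ (36 * t) (t * α) n ⟩
    36 * t * (t * α) ∸ 36 * t * n     <⟨ m<n+o⇒m∸n<o _ (36 * t * n) {{>-nonZero n>0}} bound ⟩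
    n                                 ∎
    where
    bound : 36 * t * (t * α) < 36 * t * n + n
    bound = subst₂ _<_ (*-assoc (36 * t) t α)
      (trans (*-distribʳ-+ n (36 * t) 1) (cong (36 * t * n +_) (+-identityʳ n))) 36t²α<[36t+1]n

  -- Since t ≥ 2, we have 2α ≤ n + η and 72η < n, so 144α ≤ 73n and hence 71α ≤ 73δ. The rounder
  -- constant 4/9 is enough for the contradiction.
  4n≤9δ : 4 * n ≤ 9 * δ
  4n≤9δ = begin
    4 * n                 ≡⟨ cong (4 *_) (sym α+δ≡n) ⟩
    4 * (α + δ)           ≡⟨ *-distribˡ-+ 4 α δ ⟩
    4 * α + 4 * δ         ≤⟨ +-monoˡ-≤ (4 * δ) 4α≤5δ ⟩
    5 * δ + 4 * δ         ≡⟨ sym (*-distribʳ-+ δ 5 4) ⟩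
    9 * δ                 ∎
    where
    71α≤73δ : 71 * α ≤ 73 * δ
    71α≤73δ = +-cancelˡ-≤ (73 * α) _ _ (begin
      73 * α + 71 * α      ≡⟨ sym (*-distribʳ-+ α 73 71) ⟩
      144 * α              ≡⟨ *-assoc 72 2 α ⟩
      72 * (2 * α)         ≤⟨ *-monoʳ-≤ 72 (≤-trans (*-monoˡ-≤ α {2} {t} (m≤m+n 2 p)) α-bound) ⟩
      72 * (n + η)         ≡⟨ *-distribˡ-+ 72 n η ⟩
      72 * n + 72 * η      ≤⟨ +-monoʳ-≤ (72 * n) (≤-trans (*-monoˡ-≤ η (*-monoʳ-≤ 36 {2} {t} (m≤m+n 2 p))) (<⇒≤ 36tη<n)) ⟩
      72 * n + n           ≡⟨ +-comm (72 * n) n ⟩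
      73 * n               ≡⟨ cong (73 *_) (sym α+δ≡n) ⟩
      73 * (α + δ)         ≡⟨ *-distribˡ-+ 73 α δ ⟩
      73 * α + 73 * δ      ∎)
    4α≤5δ : 4 * α ≤ 5 * δ
    4α≤5δ = *-cancelˡ-≤ 71 (begin
      71 * (4 * α)    ≡⟨ swap α ⟩
      4 * (71 * α)    ≤⟨ *-monoʳ-≤ 4 71α≤73δ ⟩
      4 * (73 * δ)    ≤⟨ m≤m+n _ (63 * δ) ⟩
      4 * (73 * δ) + 63 * δ ≡⟨ collect δ ⟩
      71 * (5 * δ)    ∎)
      where
      swap : ∀ α → 71 * (4 * α) ≡ 4 * (71 * α)
      swap = solve-∀
      collect : ∀ δ → 4 * (73 * δ) + 63 * δ ≡ 71 * (5 * δ)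
      collect = solve-∀

  δ>0 : 0 < δ
  δ>0 = n≢0⇒n>0 λ δ≡0 → n≮0 (≤-trans (≤-trans n>0 (m≤m+n n (3 * n))) (subst (λ x → 4 * n ≤ 9 * x) δ≡0 4n≤9δ))

  -- As sα < n ≤ 9δ/4, the assumed inequality gives 4sδ ≤ (16s + 22t²)η. Multiplying by 144t and
  -- using 36tη < n ≤ 9δ/4 leaves 576ts ≤ 144s + 198t². For t = 2 this reads 1152 ≤ 936; in general
  -- the left side is larger by 216 + 792p + 378p².
  codegree-inequality-fails : ¬ (s * δ * δ ≤ 4 * s * δ * η + t * t * (δ * η + 2 * s * α * η))
  codegree-inequality-fails I = <⇒≱ (≤-trans (s≤s (m≤m+n _ (215 + 792 * p + 378 * p * p))) (≤-reflexive (gap p))) (*-cancelʳ-≤ _ _ δ {{>-nonZero δ>0}} (begin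
    576 * t * s * δ                         ≡⟨ e₁ t s δ ⟩
    4 * (36 * t * (4 * s * δ))              ≤⟨ *-monoʳ-≤ 4 (*-monoʳ-≤ (36 * t) 4sδ≤) ⟩
    4 * (36 * t * (Q * η))                  ≡⟨ e₂ (36 * t) Q η ⟩
    4 * (36 * t * η) * Q                    ≤⟨ *-monoˡ-≤ Q (*-monoʳ-≤ 4 (<⇒≤ 36tη<n)) ⟩
    4 * n * Q                               ≤⟨ *-monoˡ-≤ Q 4n≤9δ ⟩
    9 * δ * Q                               ≡⟨ e₃ s t δ ⟩
    (144 * s + 198 * (t * t)) * δ           ∎))
    where
    Q = 16 * s + 22 * (t * t)
    4sδ≤ : 4 * s * δ ≤ Q * η
    4sδ≤ = *-cancelʳ-≤ _ _ δ {{>-nonZero δ>0}} (begin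
      4 * s * δ * δ
        ≡⟨ e₄ s δ ⟩
      4 * (s * δ * δ)
        ≤⟨ *-monoʳ-≤ 4 I ⟩
      4 * (4 * s * δ * η + t * t * (δ * η + 2 * s * α * η))
        ≡⟨ e₅ s δ η t α ⟩
      16 * s * δ * η + t * t * (4 * δ * η + 8 * η * (s * α))
        ≤⟨ +-monoʳ-≤ (16 * s * δ * η) (*-monoʳ-≤ (t * t) (+-monoʳ-≤ (4 * δ * η) (*-monoʳ-≤ (8 * η) (<⇒≤ sα<n)))) ⟩
      16 * s * δ * η + t * t * (4 * δ * η + 8 * η * n)
        ≡⟨ e₆ s δ η t n ⟩
      16 * s * δ * η + t * t * (4 * δ * η + 2 * η * (4 * n))
        ≤⟨ +-monoʳ-≤ (16 * s * δ * η) (*-monoʳ-≤ (t * t) (+-monoʳ-≤ (4 * δ * η) (*-monoʳ-≤ (2 * η) 4n≤9δ))) ⟩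
      16 * s * δ * η + t * t * (4 * δ * η + 2 * η * (9 * δ))
        ≡⟨ e₇ s δ η t ⟩
      Q * η * δ ∎)
      where
      e₄ : ∀ s δ → 4 * s * δ * δ ≡ 4 * (s * δ * δ)
      e₄ = solve-∀
      e₅ : ∀ s δ η t α → 4 * (4 * s * δ * η + t * t * (δ * η + 2 * s * α * η))
         ≡ 16 * s * δ * η + t * t * (4 * δ * η + 8 * η * (s * α))
      e₅ = solve-∀
      e₆ : ∀ s δ η t n → 16 * s * δ * η + t * t * (4 * δ * η + 8 * η * n)
         ≡ 16 * s * δ * η + t * t * (4 * δ * η + 2 * η * (4 * n))
      e₆ = solve-∀
      e₇ : ∀ s δ η t → 16 * s * δ * η + t * t * (4 * δ * η + 2 * η * (9 * δ))
         ≡ (16 * s + 22 * (t * t)) * η * δ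
      e₇ = solve-∀
    e₁ : ∀ t s δ → 576 * t * s * δ ≡ 4 * (36 * t * (4 * s * δ))
    e₁ = solve-∀
    e₂ : ∀ x q η → 4 * (x * (q * η)) ≡ 4 * (x * η) * q
    e₂ = solve-∀
    e₃ : ∀ s t δ → 9 * δ * (16 * s + 22 * (t * t)) ≡ (144 * s + 198 * (t * t)) * δ
    e₃ = solve-∀
    gap : ∀ p → suc (144 * (1 + p) + 198 * ((2 + p) * (2 + p)) + (215 + 792 * p + 378 * p * p)) ≡ 576 * (2 + p) * (1 + p)
    gap = solve-∀

-- The bound for 3-graphs.

minCodegree-bound : ∀ n p δ (T : Fin n → Fin n → Fin n → Bool) →
  (∀ a b c → T a b c ≡ T b a c) → (∀ a b c → T a b c ≡ T a c b) →
  (∀ a b c → T a b c ≡ true → δ ≤ sum λ z → 𝟙 (T a b z)) →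
  (∀ a xs → length xs ≡ 3 + p → ¬ AllPairs (λ x y → T a x y ≡ true) xs) →
  (∃[ a ] ∃[ b ] ∃[ c ] (T a b c ≡ true)) →
  36 * (2 + p) * (2 + p) * δ ≤ (36 * (2 + p) * (2 + p) ∸ 36 * (2 + p) ∸ 1) * n
minCodegree-bound n p δ T swap₁₂ swap₂₃ minCodegree free (a , b , c , abc) = ≮⇒≥ λ large →
  let α+δ≡n = m∸n+n≡m δ≤n
      module A = Arithmetic p n (n ∸ δ) δ α+δ≡n large
      module G = ThreeGraph n (1 + p) (n ∸ δ) δ A.η T swap₁₂ swap₂₃ α+δ≡n A.sα<n A.α-bound minCodegree free
  in A.codegree-inequality-fails (G.codegree-inequality abc)
  where
  -- Codegrees are at most `n`, so `n ∸ δ` is a genuine difference.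
  δ≤n : δ ≤ n
  δ≤n = ≤-trans (minCodegree a b c abc)
    (≤-trans (m≤m+n _ _) (≤-reflexive (sum-𝟙+sum-𝟙-not (T a b))))

-- Inserting vertices into subsets.

insert : Subset n → Fin n → Subset n
insert p x = p [ x ]≔ true

insert-comm : ∀ (p : Subset n) x y → insert (insert p x) y ≡ insert (insert p y) x
insert-comm (b ∷ p) zero    zero    = refl
insert-comm (b ∷ p) zero    (suc y) = refl
insert-comm (b ∷ p) (suc x) zero    = refl
insert-comm (b ∷ p) (suc x) (suc y) = cong (b ∷_) (insert-comm p x y)

∣insert∣≤ : ∀ (p : Subset n) x → ∣ insert p x ∣ ≤ suc ∣ p ∣
∣insert∣≤ (true  ∷ p) zero    = n≤1+n _
∣insert∣≤ (false ∷ p) zero    = ≤-refl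
∣insert∣≤ (true  ∷ p) (suc x) = s≤s (∣insert∣≤ p x)
∣insert∣≤ (false ∷ p) (suc x) = ∣insert∣≤ p x

insert-member : ∀ (p : Subset n) x → lookup p x ≡ true → insert p x ≡ p
insert-member (b ∷ p) zero    refl = refl
insert-member (b ∷ p) (suc x) e    = cong (b ∷_) (insert-member p x e)

-- Inserting a member changes nothing, so reaching the maximal size forces `x` to be new. This
-- recovers the distinctness of vertices from the size of an edge.
insert-fresh : ∀ {m} (p : Subset n) x → ∣ p ∣ ≤ m → ∣ insert p x ∣ ≡ suc m → ∣ p ∣ ≡ m × lookup p x ≡ false
insert-fresh p x p≤m e =
  ≤-antisym p≤m (≤-pred (subst (_≤ suc ∣ p ∣) e (∣insert∣≤ p x))) , ¬-not λ x∈p →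
    <⇒≢ (s≤s p≤m) (trans (cong ∣_∣ (sym (insert-member p x x∈p))) e)

lookup-insert⁺ : ∀ (p : Subset n) x v → v ≡ x ⊎ lookup p v ≡ true → lookup (insert p x) v ≡ true
lookup-insert⁺ p x .x (inj₁ refl) = lookup∘update x p true
lookup-insert⁺ p x v  (inj₂ v∈p) with v ≟ x
... | yes refl = lookup∘update x p true
... | no  v≢x  = trans (lookup∘update′ v≢x p true) v∈p

lookup-insert⁻ : ∀ (p : Subset n) x v → lookup (insert p x) v ≡ true → v ≡ x ⊎ lookup p v ≡ true
lookup-insert⁻ p x v h with v ≟ x
... | yes v≡x = inj₁ v≡x
... | no  v≢x = inj₂ (trans (sym (lookup∘update′ v≢x p true)) h)

removeOne : ∀ {m} (p : Subset n) → ∣ p ∣ ≡ suc m → ∃[ q ] ∃[ x ] (insert q x ≡ p × ∣ q ∣ ≡ m)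
removeOne (true  ∷ p) e = false ∷ p , zero , refl , suc-injective e
removeOne (false ∷ p) e =
  let q , x , eq , size = removeOne p e in false ∷ q , suc x , cong (false ∷_) eq , size

enumerate : ∀ {m} (p : Subset n) → ∣ p ∣ ≡ m → ∃[ f ] (Injective _≡_ _≡_ f
  × (∀ (i : Fin m) → lookup p (f i) ≡ true) × (∀ v → lookup p v ≡ true → ∃[ i ] (f i ≡ v)))
enumerate [] refl = (λ ()) , (λ {}) , (λ ()) , λ ()
enumerate (true ∷ p) refl
  with f , inj , into , onto ← enumerate p refl
  = f′
  , (λ { {zero} {zero} _ → refl ; {suc i} {suc j} e → cong suc (inj (Fin.suc-injective e)) })
  , (λ { zero → refl ; (suc i) → into i })
  , (λ { zero _ → zero , refl ; (suc v) v∈p → let i , e = onto v v∈p in suc i , cong suc e })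
  where
  f′ : Fin (suc ∣ p ∣) → Fin _
  f′ zero    = zero
  f′ (suc i) = suc (f i)
enumerate (false ∷ p) refl
  with f , inj , into , onto ← enumerate p refl
  = (λ i → suc (f i)) , (λ e → inj (Fin.suc-injective e)) , into
  , λ { (suc v) v∈p → let i , e = onto v v∈p in i , cong suc e }

subset-ext : (p q : Subset n) → (∀ v → lookup p v ≡ true → lookup q v ≡ true) →
  (∀ v → lookup q v ≡ true → lookup p v ≡ true) → p ≡ q
subset-ext p q p⊆q q⊆p =
  trans (sym (tabulate∘lookup p)) (trans (tabulate-cong eq) (tabulate∘lookup q))
  where
  eq : ∀ v → lookup p v ≡ lookup q v
  eq v with lookup p v in pv | lookup q v in qv
  ... | true  | true  = refl
  ... | false | false = refl
  ... | true  | false = trans (sym (p⊆q v pv)) qv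
  ... | false | true  = trans (sym pv) (q⊆p v qv)

-- Boolean predicates on lists.

∧-true⁻ : ∀ {a b} → a ∧ b ≡ true → a ≡ true × b ≡ true
∧-true⁻ {true} e = refl , e

module _ {A : Set} where

  length-filterᵇ-++ : ∀ (p : A → Bool) xs ys →
    length (filterᵇ p (xs ++ ys)) ≡ length (filterᵇ p xs) + length (filterᵇ p ys)
  length-filterᵇ-++ p []       ys = refl
  length-filterᵇ-++ p (x ∷ xs) ys with p x
  ... | true  = cong suc (length-filterᵇ-++ p xs ys)
  ... | false = length-filterᵇ-++ p xs ys

  length-filterᵇ-map : ∀ {B : Set} (p : B → Bool) (f : A → B) xs →
    length (filterᵇ p (map f xs)) ≡ length (filterᵇ (p ∘ f) xs)
  length-filterᵇ-map p f []       = refl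
  length-filterᵇ-map p f (x ∷ xs) with p (f x)
  ... | true  = cong suc (length-filterᵇ-map p f xs)
  ... | false = length-filterᵇ-map p f xs

  length-filterᵇ-none : ∀ (p : A → Bool) xs → (∀ x → p x ≡ false) → length (filterᵇ p xs) ≡ 0
  length-filterᵇ-none p []       none = refl
  length-filterᵇ-none p (x ∷ xs) none rewrite none x = length-filterᵇ-none p xs none

  ∈-filterᵇ⁺ : ∀ (p : A → Bool) {x xs} → x ∈ xs → p x ≡ true → x ∈ filterᵇ p xs
  ∈-filterᵇ⁺ p (here refl) e rewrite e = here refl
  ∈-filterᵇ⁺ p {xs = y ∷ ys} (there x∈) e with p y
  ... | true  = there (∈-filterᵇ⁺ p x∈ e)
  ... | false = ∈-filterᵇ⁺ p x∈ e

  ∈-filterᵇ⁻ : ∀ (p : A → Bool) {x} xs → x ∈ filterᵇ p xs → x ∈ xs × p x ≡ true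
  ∈-filterᵇ⁻ p (y ∷ ys) x∈ with p y in eq
  ... | false = let x∈ys , px = ∈-filterᵇ⁻ p ys x∈ in there x∈ys , px
  ∈-filterᵇ⁻ p (y ∷ ys) (here refl) | true = here refl , eq
  ∈-filterᵇ⁻ p (y ∷ ys) (there x∈)  | true = let x∈ys , px = ∈-filterᵇ⁻ p ys x∈ in there x∈ys , px

  filterᵇ-unique : ∀ (p : A → Bool) {xs} → AllPairs _≢_ xs → AllPairs _≢_ (filterᵇ p xs)
  filterᵇ-unique p [] = []
  filterᵇ-unique p {x ∷ xs} (x≢ ∷ u) with p x
  ... | false = filterᵇ-unique p u
  ... | true  = All.tabulate (λ y∈ → All.lookup x≢ (proj₁ (∈-filterᵇ⁻ p xs y∈))) ∷ filterᵇ-unique p u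

  any-true⁺ : ∀ (p : A → Bool) {x xs} → x ∈ xs → p x ≡ true → any p xs ≡ true
  any-true⁺ p (here refl) e rewrite e = refl
  any-true⁺ p {xs = y ∷ ys} (there x∈) e with p y
  ... | true  = refl
  ... | false = any-true⁺ p x∈ e

  any-true⁻ : ∀ (p : A → Bool) xs → any p xs ≡ true → ∃[ x ] (p x ≡ true)
  any-true⁻ p (x ∷ xs) e with p x in eq
  ... | true  = x , eq
  ... | false = any-true⁻ p xs e

  all-true⁻ : ∀ (p : A → Bool) {x xs} → all p xs ≡ true → x ∈ xs → p x ≡ true
  all-true⁻ p e (here refl) = proj₁ (∧-true⁻ e)
  all-true⁻ p {xs = y ∷ ys} e (there x∈) = all-true⁻ p (proj₂ (∧-true⁻ {p y} e)) x∈

  -- `AllPairs` relates earlier entries to later ones only; symmetry supplies the other order, which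
  -- `petals` in `Daisy` asks for.
  allPairs-lookup : ∀ {R : A → A → Set} (R-sym : ∀ {x y} → R x y → R y x) {m} xs → length xs ≡ m →
    AllPairs R xs → Σ[ x ∈ (Fin m → A) ] (∀ i j → i ≢ j → R (x i) (x j))
  allPairs-lookup {R} R-sym xs refl pairs = List.lookup xs , go pairs
    where
    go : ∀ {xs} → AllPairs R xs → ∀ i j → i ≢ j → R (List.lookup xs i) (List.lookup xs j)
    go (_ ∷ _)  zero    zero    i≢j = ⊥-elim (i≢j refl)
    go (r ∷ _)  zero    (suc j) _   = All.lookup r (∈-lookup j)
    go (r ∷ _)  (suc i) zero    _   = R-sym (All.lookup r (∈-lookup i))
    go (_ ∷ rs) (suc i) (suc j) i≢j = go rs i j (λ e → i≢j (cong suc e))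

∈-allSubsets : (p : Subset n) → p ∈ allSubsets n
∈-allSubsets []          = here refl
∈-allSubsets (true  ∷ p) = ∈-++⁺ˡ (∈-map⁺ (true ∷_) (∈-allSubsets p))
∈-allSubsets {suc n} (false ∷ p) = ∈-++⁺ʳ (map (true ∷_) (allSubsets n)) (∈-map⁺ (false ∷_) (∈-allSubsets p))

minList≤ : ∀ {x} xs → x ∈ xs → minList xs ≤ x
minList≤ (y ∷ ys) (here refl) = base ys
  where
  base : ∀ ys → List.foldr _⊓_ y ys ≤ y
  base []       = ≤-refl
  base (z ∷ zs) = ≤-trans (m⊓n≤n z _) (base zs)
minList≤ {x} (y ∷ ys) (there x∈) = step ys x∈
  where
  step : ∀ ys → x ∈ ys → List.foldr _⊓_ y ys ≤ x
  step (z ∷ zs) (here refl) = m⊓n≤m z _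
  step (z ∷ zs) (there x∈)  = ≤-trans (m⊓n≤n z _) (step zs x∈)

⊆ᵇ-insert : ∀ (p : Subset n) x → p ⊆ᵇ insert p x ≡ true
⊆ᵇ-insert p x = go p x
  where
  ⊆ᵇ-refl : ∀ {n} (p : Subset n) → p ⊆ᵇ p ≡ true
  ⊆ᵇ-refl []          = refl
  ⊆ᵇ-refl (true  ∷ p) = ⊆ᵇ-refl p
  ⊆ᵇ-refl (false ∷ p) = ⊆ᵇ-refl p
  go : ∀ {n} (p : Subset n) x → p ⊆ᵇ insert p x ≡ true
  go (true  ∷ p) zero    = ⊆ᵇ-refl p
  go (false ∷ p) zero    = ⊆ᵇ-refl p
  go (true  ∷ p) (suc x) = go p x
  go (false ∷ p) (suc x) = go p x

⊆ᵇ⇒∣∣≤ : ∀ (p q : Subset n) → p ⊆ᵇ q ≡ true → ∣ p ∣ ≤ ∣ q ∣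
⊆ᵇ⇒∣∣≤ []          []          _ = z≤n
⊆ᵇ⇒∣∣≤ (true  ∷ p) (true  ∷ q) e = s≤s (⊆ᵇ⇒∣∣≤ p q e)
⊆ᵇ⇒∣∣≤ (false ∷ p) (true  ∷ q) e = m≤n⇒m≤1+n (⊆ᵇ⇒∣∣≤ p q e)
⊆ᵇ⇒∣∣≤ (false ∷ p) (false ∷ q) e = ⊆ᵇ⇒∣∣≤ p q e

-- Codegrees as sums over vertices.

countSubsets : (Subset n → Bool) → ℕ
countSubsets {n} P = length (filterᵇ P (allSubsets n))

countSubsets-suc : ∀ (P : Subset (suc n) → Bool) →
  countSubsets P ≡ countSubsets (P ∘ (true ∷_)) + countSubsets (P ∘ (false ∷_))
countSubsets-suc {n} P = trans
  (length-filterᵇ-++ P (map (true ∷_) (allSubsets n)) (map (false ∷_) (allSubsets n)))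
  (cong₂ _+_ (length-filterᵇ-map P (true ∷_) (allSubsets n)) (length-filterᵇ-map P (false ∷_) (allSubsets n)))

countSubsets-none : ∀ (P : Subset n → Bool) → (∀ e → ¬ P e ≡ true) → countSubsets P ≡ 0
countSubsets-none P none = length-filterᵇ-none P (allSubsets _) λ e → ¬-not (none e)

-- A superset of `S` of the same size is `S` itself, so `P` has at most one witness.
countSubsets-same-size : ∀ (S : Subset n) P → (∀ e → P e ≡ true → S ⊆ᵇ e ≡ true × ∣ e ∣ ≡ ∣ S ∣) →
  countSubsets P ≤ 𝟙 (P S)
countSubsets-same-size [] P h with P []
... | true  = ≤-refl
... | false = z≤n
countSubsets-same-size (true ∷ S) P h = begin
  countSubsets P                                             ≡⟨ countSubsets-suc P ⟩
  countSubsets (P ∘ (true ∷_)) + countSubsets (P ∘ (false ∷_))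
    ≡⟨ cong (countSubsets (P ∘ (true ∷_)) +_) (countSubsets-none (P ∘ (false ∷_)) λ e Pe → case proj₁ (h _ Pe) of λ ()) ⟩
  countSubsets (P ∘ (true ∷_)) + 0                           ≡⟨ +-identityʳ _ ⟩
  countSubsets (P ∘ (true ∷_))
    ≤⟨ countSubsets-same-size S (P ∘ (true ∷_)) (λ e Pe → proj₁ (h _ Pe) , suc-injective (proj₂ (h _ Pe))) ⟩
  𝟙 (P (true ∷ S))                                           ∎
  where open ≤-Reasoning
countSubsets-same-size (false ∷ S) P h = begin
  countSubsets P                                             ≡⟨ countSubsets-suc P ⟩
  countSubsets (P ∘ (true ∷_)) + countSubsets (P ∘ (false ∷_))
    ≡⟨ cong (_+ countSubsets (P ∘ (false ∷_))) (countSubsets-none (P ∘ (true ∷_)) λ e Pe →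
         <⇒≱ (≤-reflexive (proj₂ (h _ Pe))) (⊆ᵇ⇒∣∣≤ S e (proj₁ (h _ Pe)))) ⟩
  countSubsets (P ∘ (false ∷_))
    ≤⟨ countSubsets-same-size S (P ∘ (false ∷_)) (λ e Pe → h _ Pe) ⟩
  𝟙 (P (false ∷ S))                                          ∎
  where open ≤-Reasoning

-- At a first vertex outside `S`, the subsets taking it agree with `S` elsewhere and give the term
-- for `z = zero`; the others recurse. Terms with `z` in `S` are discarded, only an upper bound
-- being claimed.
countSubsets-one-larger : ∀ (S : Subset n) P → (∀ e → P e ≡ true → S ⊆ᵇ e ≡ true × ∣ e ∣ ≡ suc ∣ S ∣) →
  countSubsets P ≤ sum λ z → 𝟙 (P (insert S z))
countSubsets-one-larger [] P h =
  ≤-reflexive (countSubsets-none P λ { [] Pe → case proj₂ (h [] Pe) of λ () })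
countSubsets-one-larger (true ∷ S) P h = begin
  countSubsets P                                             ≡⟨ countSubsets-suc P ⟩
  countSubsets (P ∘ (true ∷_)) + countSubsets (P ∘ (false ∷_))
    ≡⟨ cong (countSubsets (P ∘ (true ∷_)) +_) (countSubsets-none (P ∘ (false ∷_)) λ e Pe → case proj₁ (h _ Pe) of λ ()) ⟩
  countSubsets (P ∘ (true ∷_)) + 0                           ≡⟨ +-identityʳ _ ⟩
  countSubsets (P ∘ (true ∷_))
    ≤⟨ countSubsets-one-larger S (P ∘ (true ∷_)) (λ e Pe → proj₁ (h _ Pe) , suc-injective (proj₂ (h _ Pe))) ⟩
  (sum λ z → 𝟙 (P (true ∷ insert S z)))                      ≤⟨ m≤n+m _ (𝟙 (P (true ∷ S))) ⟩
  (sum λ z → 𝟙 (P (insert (true ∷ S) z)))                    ∎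
  where open ≤-Reasoning
countSubsets-one-larger (false ∷ S) P h = begin
  countSubsets P                                             ≡⟨ countSubsets-suc P ⟩
  countSubsets (P ∘ (true ∷_)) + countSubsets (P ∘ (false ∷_))
    ≤⟨ +-mono-≤
         (countSubsets-same-size S (P ∘ (true ∷_)) (λ e Pe → proj₁ (h _ Pe) , suc-injective (proj₂ (h _ Pe))))
         (countSubsets-one-larger S (P ∘ (false ∷_)) (λ e Pe → h _ Pe)) ⟩
  (sum λ z → 𝟙 (P (insert (false ∷ S) z)))                   ∎
  where open ≤-Reasoning

codeg≤ : ∀ (H : Hypergraph n) S → Uniform (suc ∣ S ∣) H → codeg H S ≤ sum λ z → 𝟙 (H (insert S z))
codeg≤ H S uniform = ≤-trans
  (countSubsets-one-larger S (λ e → H e ∧ (S ⊆ᵇ e)) λ e Pe →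
    proj₂ (∧-true⁻ {H e} Pe) , uniform e (proj₁ (∧-true⁻ Pe)))
  (sum-mono λ z → drop (H (insert S z)) (S ⊆ᵇ insert S z))
  where
  drop : ∀ a b → 𝟙 (a ∧ b) ≤ 𝟙 a
  drop true  b = 𝟙≤1 b
  drop false b = z≤n

-- The edge `insert S z` makes the codegree of `S` positive, so that codegree takes part in the
-- minimum.
posCodeg≤ : ∀ {m} (H : Hypergraph n) S z → Uniform (suc m) H → H (insert S z) ≡ true → ∣ S ∣ ≡ m →
  posCodeg (suc m) H ≤ sum λ z → 𝟙 (H (insert S z))
posCodeg≤ {m = m} H S z uniform HSz refl = ≤-trans
  (minList≤ _ (∈-filterᵇ⁺ (λ d → 0 <ᵇ d)
    (∈-map⁺ (codeg H) (∈-filterᵇ⁺ (λ S → ∣ S ∣ ≡ᵇ m) (∈-allSubsets S) (≡ᵇ-refl m)))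
    (positive (∈-filterᵇ⁺ (λ e → H e ∧ (S ⊆ᵇ e)) (∈-allSubsets (insert S z)) edge))))
  (codeg≤ H S uniform)
  where
  ≡ᵇ-refl : ∀ m → (m ≡ᵇ m) ≡ true
  ≡ᵇ-refl zero    = refl
  ≡ᵇ-refl (suc m) = ≡ᵇ-refl m
  edge : H (insert S z) ∧ (S ⊆ᵇ insert S z) ≡ true
  edge rewrite HSz = ⊆ᵇ-insert S z
  positive : ∀ {A : Set} {x : A} {xs} → x ∈ xs → (0 <ᵇ length xs) ≡ true
  positive (here _)  = refl
  positive (there _) = refl

-- Building a daisy from a kernel and a clique in its link.

module Daisy (r q : ℕ) (H : Hypergraph n) (kernel : Subset n) (x : Fin q → Fin n)
  (∣kernel∣ : ∣ kernel ∣ ≡ r ∸ 2)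
  (x-injective : Injective _≡_ _≡_ x)
  (x∉kernel : ∀ i → lookup kernel (x i) ≡ false)
  (petals : ∀ i j → i ≢ j → H (insert (insert kernel (x i)) (x j)) ≡ true)
  where

  k : ℕ
  k = r ∸ 2

  f : Fin k → Fin n
  f = proj₁ (enumerate kernel ∣kernel∣)

  f-injective : Injective _≡_ _≡_ f
  f-injective = proj₁ (proj₂ (enumerate kernel ∣kernel∣))

  f∈kernel : ∀ i → lookup kernel (f i) ≡ true
  f∈kernel = proj₁ (proj₂ (proj₂ (enumerate kernel ∣kernel∣)))

  f-onto : ∀ v → lookup kernel v ≡ true → ∃[ i ] (f i ≡ v)
  f-onto = proj₂ (proj₂ (proj₂ (enumerate kernel ∣kernel∣)))

  -- This follows the vertex order of `daisy`: clique first, kernel after.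
  embed : Fin (q + k) → Fin n
  embed u = [ x , f ]′ (splitAt q u)

  embed-↑ˡ : ∀ i → embed (i ↑ˡ k) ≡ x i
  embed-↑ˡ i = cong [ x , f ]′ (splitAt-↑ˡ q i k)

  embed-↑ʳ : ∀ i → embed (q ↑ʳ i) ≡ f i
  embed-↑ʳ i = cong [ x , f ]′ (splitAt-↑ʳ q k i)

  data View : Fin (q + k) → Set where
    clique : ∀ i → View (i ↑ˡ k)
    kern   : ∀ i → View (q ↑ʳ i)

  view : ∀ u → View u
  view u with splitAt q u in eq
  ... | inj₁ i = subst View (splitAt⁻¹-↑ˡ eq) (clique i)
  ... | inj₂ i = subst View (splitAt⁻¹-↑ʳ eq) (kern i)

  x≢f : ∀ i j → x i ≢ f j
  x≢f i j e with () ← trans (sym (x∉kernel i)) (trans (cong (lookup kernel) e) (f∈kernel j))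

  embed-injective : Injective _≡_ _≡_ embed
  embed-injective {u} {v} e with view u | view v
  ... | clique i | clique j = cong (_↑ˡ k) (x-injective (trans (sym (embed-↑ˡ i)) (trans e (embed-↑ˡ j))))
  ... | clique i | kern j   = ⊥-elim (x≢f i j (trans (sym (embed-↑ˡ i)) (trans e (embed-↑ʳ j))))
  ... | kern i   | clique j = ⊥-elim (x≢f j i (trans (sym (embed-↑ˡ j)) (trans (sym e) (embed-↑ʳ i))))
  ... | kern i   | kern j   = cong (q ↑ʳ_) (f-injective (trans (sym (embed-↑ʳ i)) (trans e (embed-↑ʳ j))))

  ↑ˡ<ᵇ : ∀ i → (toℕ (i ↑ˡ k) <ᵇ q) ≡ true
  ↑ˡ<ᵇ i = Equivalence.to T-≡ (<⇒<ᵇ (subst (_< q) (sym (toℕ-↑ˡ i k)) (toℕ<n i)))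

  ↑ʳ≮ᵇ : ∀ (i : Fin k) → (toℕ (q ↑ʳ i) <ᵇ q) ≡ false
  ↑ʳ≮ᵇ i = ¬-not λ e → <⇒≱ (<ᵇ⇒< _ q (Equivalence.from T-≡ e)) (≤-trans (m≤m+n q (toℕ i)) (≤-reflexive (sym (toℕ-↑ʳ q i))))

  image⁺ : ∀ e u → lookup e u ≡ true → lookup (image embed e) (embed u) ≡ true
  image⁺ e u u∈e = trans (lookup∘tabulate _ (embed u))
    (any-true⁺ (λ w → lookup e w ∧ ⌊ embed w ≟ embed u ⌋) (∈-allFin u) hit)
    where
    hit : lookup e u ∧ ⌊ embed u ≟ embed u ⌋ ≡ true
    hit rewrite u∈e with embed u ≟ embed u
    ... | yes _ = refl
    ... | no ≢  = ⊥-elim (≢ refl)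

  image⁻ : ∀ e v → lookup (image embed e) v ≡ true → ∃[ u ] (lookup e u ≡ true × embed u ≡ v)
  image⁻ e v h
    with u , p ← any-true⁻ (λ w → lookup e w ∧ ⌊ embed w ≟ v ⌋) (allFin _) (trans (sym (lookup∘tabulate _ v)) h)
    with u∈e , q ← ∧-true⁻ {lookup e u} p
    with embed u ≟ v
  ... | yes u↦v = u , u∈e , u↦v

  isCliqueMember : Subset (q + k) → Fin (q + k) → Bool
  isCliqueMember e u = lookup e u ∧ (toℕ u <ᵇ q)

  -- `allFin` has no duplicates, so a filtered list of length 2 holds two distinct vertices, and
  -- every clique member of `e` occurs in it.
  exactly-two : ∀ e → (length (filterᵇ (isCliqueMember e) (allFin _)) ≡ᵇ 2) ≡ true →
    ∃[ i ] ∃[ j ] (i ≢ j × lookup e (i ↑ˡ k) ≡ true × lookup e (j ↑ˡ k) ≡ true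
      × (∀ l → lookup e (l ↑ˡ k) ≡ true → l ≡ i ⊎ l ≡ j))
  exactly-two e two
    with filterᵇ (isCliqueMember e) (allFin _) in eq
       | filterᵇ-unique (isCliqueMember e) (allFin⁺ (q + k))
  ... | u ∷ v ∷ [] | (u≢v ∷ []) ∷ _
    with u∈e , u<q ← ∧-true⁻ {lookup e u} (proj₂ (∈-filterᵇ⁻ (isCliqueMember e) (allFin _) (subst (u ∈_) (sym eq) (here refl))))
    with v∈e , v<q ← ∧-true⁻ {lookup e v} (proj₂ (∈-filterᵇ⁻ (isCliqueMember e) (allFin _) (subst (v ∈_) (sym eq) (there (here refl)))))
    with view u | view v
  ... | kern i   | _        with () ← trans (sym u<q) (↑ʳ≮ᵇ i)
  ... | clique i | kern j   with () ← trans (sym v<q) (↑ʳ≮ᵇ j)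
  ... | clique i | clique j = i , j , (λ i≡j → u≢v (cong (_↑ˡ k) i≡j)) , u∈e , v∈e , only
    where
    only : ∀ l → lookup e (l ↑ˡ k) ≡ true → l ≡ i ⊎ l ≡ j
    only l l∈e with subst (l ↑ˡ k ∈_) eq (∈-filterᵇ⁺ (isCliqueMember e) (∈-allFin (l ↑ˡ k)) (cong₂ _∧_ l∈e (↑ˡ<ᵇ l)))
    ... | here l≡i         = inj₁ (↑ˡ-injective k l i l≡i)
    ... | there (here l≡j) = inj₂ (↑ˡ-injective k l j l≡j)

  -- `daisy` forces the whole kernel and exactly two clique vertices into `e`, so its image is
  -- `kernel` with `x i` and `x j`, an edge by `petals`.
  image-edge : ∀ e → daisy r q e ≡ true → H (image embed e) ≡ true
  image-edge e de
    with two , rest ← ∧-true⁻ {length (filterᵇ (isCliqueMember e) (allFin _)) ≡ᵇ 2} de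
    with i , j , i≢j , i∈e , j∈e , only ← exactly-two e two
    = trans (cong H (subset-ext _ _ ⊆ ⊇)) (petals i j i≢j)
    where
    kernel⊆e : ∀ (w : Fin k) → lookup e (q ↑ʳ w) ≡ true
    kernel⊆e w = trans (cong (_∨ lookup e (q ↑ʳ w)) (sym (↑ʳ≮ᵇ w)))
      (all-true⁻ (λ u → (toℕ u <ᵇ q) ∨ lookup e u) rest (∈-allFin (q ↑ʳ w)))
    member : ∀ v → v ≡ x j ⊎ (v ≡ x i ⊎ lookup kernel v ≡ true) →
      lookup (insert (insert kernel (x i)) (x j)) v ≡ true
    member v = lookup-insert⁺ (insert kernel (x i)) (x j) v ∘ Sum.map₂ (lookup-insert⁺ kernel (x i) v)
    ⊆ : ∀ v → lookup (image embed e) v ≡ true → lookup (insert (insert kernel (x i)) (x j)) v ≡ true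
    ⊆ v h with u , u∈e , refl ← image⁻ e v h with view u
    ... | kern w = member (embed (q ↑ʳ w)) (inj₂ (inj₂ (trans (cong (lookup kernel) (embed-↑ʳ w)) (f∈kernel w))))
    ... | clique l with only l u∈e
    ...   | inj₁ l≡i = member (embed (l ↑ˡ k)) (inj₂ (inj₁ (trans (embed-↑ˡ l) (cong x l≡i))))
    ...   | inj₂ l≡j = member (embed (l ↑ˡ k)) (inj₁ (trans (embed-↑ˡ l) (cong x l≡j)))
    ⊇ : ∀ v → lookup (insert (insert kernel (x i)) (x j)) v ≡ true → lookup (image embed e) v ≡ true
    ⊇ v h with lookup-insert⁻ (insert kernel (x i)) (x j) v h
    ... | inj₁ refl = subst (λ y → lookup (image embed e) y ≡ true) (embed-↑ˡ j) (image⁺ e _ j∈e)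
    ... | inj₂ h′ with lookup-insert⁻ kernel (x i) v h′
    ...   | inj₁ refl = subst (λ y → lookup (image embed e) y ≡ true) (embed-↑ˡ i) (image⁺ e _ i∈e)
    ...   | inj₂ v∈kernel with w , refl ← f-onto v v∈kernel =
              subst (λ y → lookup (image embed e) y ≡ true) (embed-↑ʳ w) (image⁺ e _ (kernel⊆e w))

  contains-daisy : Contains (daisy r q) H
  contains-daisy = embed , embed-injective , image-edge

-- The link of r - 3 vertices, and the theorem.

module LinkOf (m : ℕ) (H : Hypergraph n) (uniform : Uniform (3 + m) H)
  (K : Subset n) (∣K∣ : ∣ K ∣ ≡ m) where

  T : Fin n → Fin n → Fin n → Bool
  T a b c = H (insert (insert (insert K a) b) c)

  T-swap₁₂ : ∀ a b c → T a b c ≡ T b a c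
  T-swap₁₂ a b c = cong (λ p → H (insert p c)) (insert-comm K a b)

  T-swap₂₃ : ∀ a b c → T a b c ≡ T a c b
  T-swap₂₃ a b c = cong H (insert-comm (insert K a) b c)

  -- Each insertion adds at most one element, so the size `3 + m` of an edge leaves no room for a
  -- repetition.
  edge-sizes : ∀ {a b c} → T a b c ≡ true →
    (∣ insert (insert K a) b ∣ ≡ 2 + m × lookup (insert (insert K a) b) c ≡ false)
    × (∣ insert K a ∣ ≡ 1 + m × lookup (insert K a) b ≡ false)
  edge-sizes {a} {b} {c} abc =
    let ≤₁ = ≤-trans (∣insert∣≤ K a) (s≤s (≤-reflexive ∣K∣))
        ≤₂ = ≤-trans (∣insert∣≤ (insert K a) b) (s≤s ≤₁)
        s₂ = insert-fresh (insert (insert K a) b) c ≤₂ (uniform _ abc)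
    in s₂ , insert-fresh (insert K a) b ≤₁ (proj₁ s₂)

  minCodegree : ∀ a b c → T a b c ≡ true → posCodeg (3 + m) H ≤ sum λ z → 𝟙 (T a b z)
  minCodegree a b c abc =
    posCodeg≤ H (insert (insert K a) b) c uniform abc (proj₁ (proj₁ (edge-sizes abc)))

  -- The kernel is `K` with `a`, of r - 2 vertices. There are at least two clique vertices, so each
  -- lies in a pair; the sizes of the resulting edges show that it is outside the kernel and that
  -- distinct positions hold distinct vertices.
  linkClique⇒daisy : ∀ p a xs → length xs ≡ 2 + p → AllPairs (λ x y → T a x y ≡ true) xs →
    Contains (daisy (3 + m) (2 + p)) H
  linkClique⇒daisy p a xs len pairs
    with x , adj ← allPairs-lookup {R = λ x y → T a x y ≡ true} (λ {x} {y} → trans (T-swap₂₃ a y x)) xs len pairs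
    = Daisy.contains-daisy (3 + m) (2 + p) H (insert K a) x ∣kernel∣ x-injective x∉kernel adj
    where
    ∣kernel∣ : ∣ insert K a ∣ ≡ 1 + m
    ∣kernel∣ = proj₁ (proj₂ (edge-sizes (adj zero (suc zero) λ ())))
    x∉kernel : ∀ i → lookup (insert K a) (x i) ≡ false
    x∉kernel zero    = proj₂ (proj₂ (edge-sizes (adj zero (suc zero) λ ())))
    x∉kernel (suc i) = proj₂ (proj₂ (edge-sizes (adj (suc i) zero λ ())))
    x-injective : Injective _≡_ _≡_ x
    x-injective {i} {j} e with i ≟ j
    ... | yes i≡j = i≡j
    ... | no  i≢j with () ← trans (sym (proj₂ (proj₁ (edge-sizes (adj i j i≢j)))))
                       (lookup-insert⁺ (insert K a) (x i) (x j) (inj₁ (sym e)))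

posCodeg-bound : ∀ m p (H : Hypergraph n) → Uniform (3 + m) H → NonemptyGraph H →
  ¬ Contains (daisy (3 + m) (3 + p)) H →
  36 * (2 + p) * (2 + p) * posCodeg (3 + m) H ≤ (36 * (2 + p) * (2 + p) ∸ 36 * (2 + p) ∸ 1) * n
posCodeg-bound {n} m p H uniform (e , He) free
  -- Three vertices are peeled off an edge. The remaining r - 3 form `K`, and the edge itself shows
  -- that the link of `K` is nonempty.
  with e₁ , c , refl , size₁ ← removeOne e (uniform e He)
  with e₂ , b , refl , size₂ ← removeOne e₁ size₁
  with K  , a , refl , ∣K∣   ← removeOne e₂ size₂
  = minCodegree-bound n p (posCodeg (3 + m) H) T T-swap₁₂ T-swap₂₃ minCodegree
      -- `linkClique⇒daisy` counts clique sizes from 2, so `1 + p` stands for the size t + 1 = 3 +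
      -- p.
      (λ a xs len pairs → free (linkClique⇒daisy (1 + p) a xs len pairs)) (a , b , c , He)
  where open LinkOf m H uniform K ∣K∣

theorem1p5 : (r t : ℕ) → 3 ≤ r → 2 ≤ t → (k : ℕ) → 1 ≤ k →
    ∃[ N ] ((n : ℕ) → N ≤ n → (H : Hypergraph n) → Uniform r H → NonemptyGraph H →
    ¬ Contains (daisy r (suc t)) H →
    36 * t * t * k * posCodeg r H ≤ (36 * t * t ∸ 36 * t ∸ 1) * k * n + 36 * t * t * n)
theorem1p5 r t 3≤r 2≤t k _
  with m , refl ← m≤n⇒∃[o]m+o≡n 3≤r
  with p , refl ← m≤n⇒∃[o]m+o≡n 2≤t
  -- Here 1/k is the error allowed in the limit. The bound holds for every `n`, so `N` is 0, and the
  -- error term `A * n` is added in the last inequality.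
  = 0 , λ n _ H uniform nonempty free →
    let d = posCodeg (3 + m) H
        A = 36 * (2 + p) * (2 + p)
        B = A ∸ 36 * (2 + p) ∸ 1
    in begin
      A * k * d            ≡⟨ swap A k d ⟩
      k * (A * d)          ≤⟨ *-monoʳ-≤ k (posCodeg-bound m p H uniform nonempty free) ⟩
      k * (B * n)          ≡⟨ sym (swap B k n) ⟩
      B * k * n            ≤⟨ m≤m+n _ (A * n) ⟩
      B * k * n + A * n    ∎
  where
  open ≤-Reasoning
  swap : ∀ a k d → a * k * d ≡ k * (a * d)
  swap a k d = trans (cong (_* d) (*-comm a k)) (*-assoc k a d)
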